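{- Let $\mathcal{G}=(V,E,\lambda)$ be a happy compressed temporal graph with $n=|V|\ge 1$ vertices and lifetime $L(\mathcal{G})$. If $\mathcal{G}$ is acyclic, then $L(\mathcal{G})<n$.
   Context: A happy temporal graph is a triple $\mathcal{G}=(V,E,\lambda)$ where $(V,E)$ is a finite simple undirected graph (the footprint) and $\lambda:E\to\{1,2,3,\dots\}$ assigns a single time label to each edge, such that two distinct edges sharing an endpoint have different labels. It is compressed if for every edge $e$ with $\lambda(e)>1$ there is an edge $e'$ adjacent to $e$ with $\lambda(e')=\lambda(e)-1$. The lifetime $L(\mathcal{G})$ is the largest time label (with $L(\mathcal{G})=0$ if there are no edges). A temporal walk is a walk in the footprint along which edge labels are strictly increasing (so no edge is repeated). A temporal cycle is a nonempty temporal walk from a vertex to itself; $\mathcal{G}$ is acyclic if it has no temporal cycle. -}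

module Defs where

open import Data.Fin.Base using (Fin)
open import Data.List.Base using (List; []; _∷_; map; mapMaybe; cartesianProduct; allFin)
open import Data.List.Extrema.Nat using (max)
open import Data.List.Relation.Unary.Linked using (Linked)
open import Data.Maybe.Base using (Maybe; just; nothing)
open import Data.Nat.Base using (ℕ; _∸_; _≤_; _<_)
open import Data.Product.Base using (Σ; ∃-syntax; _×_; _,_)
open import Data.Sum.Base using (_⊎_)
open import Level using (0ℓ)
open import Relation.Binary.Construct.Closure.ReflexiveTransitive using (Star; ε; _◅_)
open import Relation.Binary.Core using (Rel)
open import Relation.Binary.Definitions using (Decidable; Irreflexive; Symmetric)
open import Relation.Binary.PropositionalEquality.Core using (_≡_; _≢_)
open import Relation.Nullary.Decidable.Core using (yes; no)
open import Relation.Nullary.Negation.Core using (¬_)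

record SimpleGraph (n : ℕ) : Set₁ where
  field
    Adj    : Rel (Fin n) 0ℓ
    adj?   : Decidable Adj
    symm   : Symmetric Adj
    irrefl : Irreflexive _≡_ Adj

  -- An undirected edge {u,v} is represented by either of its two
  -- orientations; _≈ₑ_ is equality of the underlying undirected edges.
  record Edge : Set where
    constructor edge
    field
      {source target} : Fin n
      adjacent        : Adj source target

  open Edge public

  _≈ₑ_ : Rel Edge 0ℓ
  e ≈ₑ e′ = (source e ≡ source e′ × target e ≡ target e′)
          ⊎ (source e ≡ target e′ × target e ≡ source e′)

  _endpointOf_ : Fin n → Edge → Set
  v endpointOf e = v ≡ source e ⊎ v ≡ target e

  AdjacentEdges : Rel Edge 0ℓ
  AdjacentEdges e e′ = ¬ (e ≈ₑ e′) × (∃[ v ] (v endpointOf e × v endpointOf e′))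

  edgeBetween? : Fin n × Fin n → Maybe Edge
  edgeBetween? (u , v) with adj? u v
  ... | yes p = just (edge p)
  ... | no  _ = nothing

  -- Every undirected edge is listed in both orientations.
  edges : List Edge
  edges = mapMaybe edgeBetween? (cartesianProduct (allFin n) (allFin n))

  Walk : Rel (Fin n) 0ℓ
  Walk = Star Adj

  walkEdges : ∀ {u v} → Walk u v → List Edge
  walkEdges ε       = []
  walkEdges (p ◅ w) = edge p ∷ walkEdges w

record HappyTemporalGraph (n : ℕ) : Set₁ where
  field
    footprint : SimpleGraph n

  open SimpleGraph footprint public

  field
    label          : Edge → ℕ
    label-cong     : ∀ {e e′} → e ≈ₑ e′ → label e ≡ label e′
    label-positive : ∀ e → 1 ≤ label e
    label-proper   : ∀ {e e′} → AdjacentEdges e e′ → label e ≢ label e′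

  Compressed : Set
  Compressed = ∀ e → 1 < label e →
    ∃[ e′ ] (AdjacentEdges e e′ × label e′ ≡ label e ∸ 1)

  lifetime : ℕ
  lifetime = max 0 (map label edges)

  IsTemporal : ∀ {u v} → Walk u v → Set
  IsTemporal w = Linked _<_ (map label (walkEdges w))

  TemporalCycle : Fin n → Set
  TemporalCycle v = Σ (Walk v v) λ w → w ≢ ε × IsTemporal w

  Acyclic : Set
  Acyclic = ∀ v → ¬ TemporalCycle v

{-# OPTIONS --safe #-}
-- Descending from an edge of label k through compressedness gives a chain of
-- edges labelled k, …, 1 with consecutive ones adjacent. Reading it upwards,
-- every vertex met so far has a temporal walk to both endpoints of the current
-- edge. If the next edge xy, attached at x, led to a vertex y met before, then
-- the temporal walk from y to x followed by xy would be a temporal cycle. So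
-- each edge adds a new vertex, and an edge of label k forces k + 1 vertices.
module Submission where

open import Defs
open import Data.Fin.Base using (Fin)
open import Data.Fin.Properties using (injective⇒≤)
import Data.List.Base as List
import Data.List.Relation.Unary.All as ListAll
open import Data.List.Extrema.Nat using (max<v⁺)
open import Data.List.Relation.Unary.All.Properties using (map⁺)
open import Data.List.Relation.Unary.Linked using (Linked; []; [-]; _∷_)
open import Data.Nat.Base using (ℕ; zero; suc; _∸_; _≤_; _≥_; _<_; z≤n; s≤s)
open import Data.Nat.Properties using (≤-reflexive; ≤-trans; n≤1+n)
open import Data.Product.Base using (Σ-syntax; _×_; _,_)
open import Data.Sum.Base using (inj₁; inj₂)
open import Data.Vec.Base using (Vec; []; _∷_; lookup)
open import Data.Vec.Relation.Unary.All as All using (All; []; _∷_)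
open import Data.Vec.Relation.Unary.AllPairs using ([]; _∷_)
open import Data.Vec.Relation.Unary.Unique.Propositional using (Unique)
open import Data.Vec.Relation.Unary.Unique.Propositional.Properties using (lookup-injective)
open import Relation.Binary.Construct.Closure.ReflexiveTransitive using (ε; _◅_)
open import Relation.Binary.PropositionalEquality using (_≡_; _≢_; refl; sym; trans; cong; subst)
open HappyTemporalGraph using (Compressed; Acyclic; lifetime)

Unique⇒length≤ : ∀ {m n} {xs : Vec (Fin n) m} → Unique xs → m ≤ n
Unique⇒length≤ {xs = xs} xs! =
  injective⇒≤ {f = lookup xs} λ {i} {j} → lookup-injective xs! i j

Linked-<-lower-head : ∀ {j k ns} → j ≤ k → Linked _<_ (k List.∷ ns) → Linked _<_ (j List.∷ ns)
Linked-<-lower-head j≤k [-]         = [-]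
Linked-<-lower-head j≤k (k<n ∷ ns↗) = ≤-trans (s≤s j≤k) k<n ∷ ns↗

module _ {n : ℕ} (G : HappyTemporalGraph n) where
  open HappyTemporalGraph G hiding (Compressed; Acyclic; lifetime)

  -- A temporal walk from u with all labels at most the index, grown at its
  -- far end (Walk grows at its near end).
  data ArrivesBy (u : Fin n) : ℕ → Fin n → Set where
    start : ∀ {k} → ArrivesBy u k u
    cross : ∀ {j k x y} → ArrivesBy u j x → (p : Adj x y) →
            j < label (edge p) → label (edge p) ≤ k → ArrivesBy u k y

  ArrivesBy-mono : ∀ {u x j k} → j ≤ k → ArrivesBy u j x → ArrivesBy u k x
  ArrivesBy-mono j≤k start               = start
  ArrivesBy-mono j≤k (cross a p i<l l≤j) = cross a p i<l (≤-trans l≤j j≤k)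

  -- Each `cross` moves from the end of the arrival to the front of the walk, until only `start` is
  -- left. The bound `k` heads the list to record that the next label exceeds it; keeping `p` apart
  -- makes the cycle nonempty.
  arrive-then-walk⇒cycle : ∀ {u k x y} → ArrivesBy u k x → (p : Adj x y) (w : Walk y u) →
    Linked _<_ (k List.∷ List.map label (walkEdges (p ◅ w))) → TemporalCycle u
  arrive-then-walk⇒cycle start p w (_ ∷ ls↗) = p ◅ w , (λ ()) , ls↗
  arrive-then-walk⇒cycle (cross a q j<l l≤k) p w ls↗ =
    arrive-then-walk⇒cycle a q (p ◅ w) (j<l ∷ Linked-<-lower-head l≤k ls↗)

  label-symm : ∀ {x y} (p : Adj x y) → label (edge (symm p)) ≡ label (edge p)
  label-symm p = label-cong (inj₂ (refl , refl))

  Converging : ℕ → Fin n → Set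
  Converging k x = Σ[ vs ∈ Vec (Fin n) (suc k) ] Unique vs × All (λ u → ArrivesBy u k x) vs

  converging₀ : ∀ x → Converging 0 x
  converging₀ x = x ∷ [] , [] ∷ [] , start ∷ []

  module _ (acyclic : Acyclic G) where

    arrivesBy⇒≢ : ∀ {u k x y} → ArrivesBy u k x → (p : Adj x y) → k < label (edge p) → y ≢ u
    arrivesBy⇒≢ a p k<l refl = acyclic _ (arrive-then-walk⇒cycle a p ε (k<l ∷ [-]))

    converging-far : ∀ {k x y} (p : Adj x y) → label (edge p) ≡ suc k →
      Converging k x → Converging (suc k) y
    converging-far {y = y} p l≡ (vs , vs! , as) =
      y ∷ vs ,
      All.map (λ a → arrivesBy⇒≢ a p k<l) as ∷ vs! ,
      start ∷ All.map (λ a → cross a p k<l (≤-reflexive l≡)) as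
      where k<l = ≤-reflexive (sym l≡)

    -- Staying at `x` still gains `y`, which reaches `x` by crossing the edge back; the older
    -- arrivals survive under the larger bound.
    converging-near : ∀ {k x y} (p : Adj x y) → label (edge p) ≡ suc k →
      Converging k x → Converging (suc k) x
    converging-near {k} {y = y} p l≡ (vs , vs! , as) =
      y ∷ vs ,
      All.map (λ a → arrivesBy⇒≢ a p (≤-reflexive (sym l≡))) as ∷ vs! ,
      -- `start` fits any bound; with 0 the strict inequality is positivity of the label.
      cross {j = 0} start (symm p) (label-positive _) (≤-reflexive (trans (label-symm p) l≡))
        ∷ All.map (ArrivesBy-mono (n≤1+n k)) as

    converging-across : ∀ {k v w} e → label e ≡ suc k → v endpointOf e → w endpointOf e →
      Converging k v → Converging (suc k) w
    converging-across (edge p) l≡ (inj₁ refl) (inj₁ refl) = converging-near p l≡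
    converging-across (edge p) l≡ (inj₁ refl) (inj₂ refl) = converging-far p l≡
    converging-across (edge p) l≡ (inj₂ refl) (inj₁ refl) =
      converging-far (symm p) (trans (label-symm p) l≡)
    converging-across (edge p) l≡ (inj₂ refl) (inj₂ refl) =
      converging-near (symm p) (trans (label-symm p) l≡)

    module _ (compressed : Compressed G) where

      -- The claim covers both endpoints because the edge with the next label may attach at either
      -- one.
      endpoint-converging : ∀ k {w} e → label e ≡ suc k → w endpointOf e → Converging (suc k) w
      endpoint-converging zero e l≡ w∈e =
        -- At label 1 the chain ends, and the count starts from the single vertex `source e`.
        converging-across e l≡ (inj₁ refl) w∈e (converging₀ (source e))
      endpoint-converging (suc k) e l≡ w∈e
        with compressed e (subst (1 <_) (sym l≡) (s≤s (s≤s z≤n)))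
      ... | e′ , (_ , _ , v∈e , v∈e′) , l′≡ =
        converging-across e l≡ v∈e w∈e
          (endpoint-converging k e′ (trans l′≡ (cong (_∸ 1) l≡)) v∈e′)

      label<n : ∀ e → label e < n
      label<n e with label e in l≡ | label-positive e
      ... | suc k | _ with endpoint-converging k e l≡ (inj₁ refl)
      -- The vector has `suc (suc k)` entries, one more than the label, so the bound is strict.
      ...   | _ , vs! , _ = Unique⇒length≤ vs!

lemma3p4 : (n : ℕ) (G : HappyTemporalGraph n) → n ≥ 1 →
    Compressed G → Acyclic G → lifetime G < n
lemma3p4 n G n≥1 compressed acyclic =
  -- `n≥1` handles the default 0 of `max`, the lifetime of an edgeless graph.
  max<v⁺ n≥1 (map⁺ (ListAll.universal (label<n G acyclic compressed) edges))
  where open HappyTemporalGraph G using (edges)
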